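{- Let $A = \begin{bmatrix} B & C \\ C^T & D \end{bmatrix}$ be a real symmetric $n\times n$ matrix, where $B$ is $k\times k$ (so $C$ is $k \times (n-k)$ and $D$ is $(n-k)\times(n-k)$). Then the following are equivalent: (a) $\{1,2,\dots,k\}$ is a P-set of $A$; (b) $\operatorname{rank}(A) = \operatorname{rank}(D) + 2k$; (c) $\{x \in \mathbb{R}^k : x^T C \in \operatorname{RS}(D)\} = \{0\}$.
   Context: All matrices are real. $\operatorname{RS}(D)$ denotes the row space of $D$. For an $n\times n$ matrix $A$ and $\alpha \subseteq \{1,\dots,n\}$, $A(\alpha)$ denotes the principal submatrix obtained by deleting the rows and columns indexed by $\alpha$, and $\nu(A)$ denotes the nullity of $A$. A set $\alpha$ is a P-set of $A$ if $\nu(A(\alpha)) = \nu(A) + |\alpha|$. -}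

module Defs where

open import Algebra.Bundles using (CommutativeRing)
open import Algebra.Core using (Op₁; Op₂)
open import Algebra.Structures using (IsCommutativeRing)
open import Data.Empty using (⊥-elim)
open import Data.Fin.Base using (Fin; zero; suc; punchIn; punchOut)
open import Data.Fin.Properties using (any?; punchIn-punchOut)
  renaming (_≟_ to _≟ᶠ_)
open import Data.Fin.Subset as Subset using (Subset; ∣_∣; ∁; inside; outside)
open import Data.Nat.Base as ℕ using (ℕ; zero; suc)
open import Data.Product.Base using (∃; _×_; _,_; proj₁; proj₂)
import Data.Vec.Base as Vec
open import Data.Vec.Functional
  using (Vector; head; tail; zipWith; insertAt; removeAt; _∷_; _++_)
open import Data.Vec.Functional.Properties using (insertAt-lookup; insertAt-punchIn)
import Data.Vec.Functional.Relation.Binary.Equality.Setoid as VectorEquality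
open import Level using (Level; _⊔_) renaming (suc to lsuc)
open import Relation.Binary.Core using (Rel)
open import Relation.Binary.Structures using (IsStrictTotalOrder)
open import Relation.Binary.PropositionalEquality as ≡ using (_≡_)
open import Relation.Nullary using (¬_; Dec; yes; no)
open import Relation.Nullary.Decidable using (¬?; decidable-stable)
open import Relation.Unary using (Pred; Satisfiable; _∈_)

-- The field ℝ, given axiomatically as a Dedekind-complete ordered field.
-- Classically such a field exists and is unique up to isomorphism. The order
-- is trichotomous in the strong sense of `IsStrictTotalOrder`, as in classical
-- analysis, so equality of reals is decidable.
record RealNumbers c ℓ₁ ℓ₂ : Set (lsuc (c ⊔ ℓ₁ ⊔ ℓ₂)) where
  infix  8 -_
  infixl 7 _*_
  infixl 6 _+_
  infix  4 _≈_ _<_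
  field
    Carrier            : Set c
    _≈_                : Rel Carrier ℓ₁
    _<_                : Rel Carrier ℓ₂
    _+_ _*_            : Op₂ Carrier
    -_                 : Op₁ Carrier
    0# 1#              : Carrier
    isCommutativeRing  : IsCommutativeRing _≈_ _+_ _*_ -_ 0# 1#
    1≉0                : ¬ 1# ≈ 0#
    inverse            : ∀ x → ¬ x ≈ 0# → ∃ λ y → x * y ≈ 1#
    isStrictTotalOrder : IsStrictTotalOrder _≈_ _<_
    +-monoʳ-<          : ∀ x {y z} → y < z → x + y < x + z
    *-pos              : ∀ {x y} → 0# < x → 0# < y → 0# < x * y

  UpperBound : ∀ {p} → Pred Carrier p → Pred Carrier (c ⊔ ℓ₂ ⊔ p)
  UpperBound P u = ∀ x → x ∈ P → ¬ u < x

  field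
    complete : (P : Pred Carrier (c ⊔ ℓ₁ ⊔ ℓ₂)) →
               Satisfiable P → Satisfiable (UpperBound P) →
               ∃ λ s → UpperBound P s × (∀ u → UpperBound P u → ¬ u < s)

  commutativeRing : CommutativeRing c ℓ₁
  commutativeRing = record { isCommutativeRing = isCommutativeRing }

module RealMatrices {c ℓ₁ ℓ₂} (ℝ : RealNumbers c ℓ₁ ℓ₂) where

  open RealNumbers ℝ using (inverse; isStrictTotalOrder)
  open CommutativeRing (RealNumbers.commutativeRing ℝ) hiding (zero)
  open IsStrictTotalOrder isStrictTotalOrder using (_≟_)
  open import Algebra.Properties.Semiring.Sum semiring
  open import Algebra.Properties.Ring ring using (-‿distribˡ-*; -‿distribʳ-*)
  open import Algebra.Properties.AbelianGroup +-abelianGroup using (inverseʳ-unique)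
  open import Relation.Binary.Reasoning.Setoid setoid
  open VectorEquality setoid public using (_≋_)

  private
    variable
      d k m n p q : ℕ

  Matrix : ℕ → ℕ → Set c
  Matrix m n = Vector (Vector Carrier n) m

  0ᵥ : Vector Carrier n
  0ᵥ _ = 0#

  infix 9 _ᵀ
  _ᵀ : Matrix m n → Matrix n m
  (M ᵀ) i j = M j i

  Symmetric : Matrix n n → Set ℓ₁
  Symmetric M = ∀ i j → M i j ≈ M j i

  block : Matrix k m → Matrix k n → Matrix p m → Matrix p n →
          Matrix (k ℕ.+ p) (m ℕ.+ n)
  block A B C D = zipWith _++_ A B ++ zipWith _++_ C D

  infixl 7 _ᵥ*_
  infixr 7 _*ᵥ_

  -- xᵀM; equivalently, the linear combination of the rows of M with
  -- coefficients x.
  _ᵥ*_ : Vector Carrier m → Matrix m n → Vector Carrier n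
  _ᵥ*_ {m} x M j = ∑[ i < m ] (x i * M i j)

  _*ᵥ_ : Matrix m n → Vector Carrier n → Vector Carrier m
  _*ᵥ_ {n = n} M x i = ∑[ j < n ] (M i j * x j)

  RS : Matrix m n → Pred (Vector Carrier n) (c ⊔ ℓ₁)
  RS M v = ∃ λ y → v ≋ y ᵥ* M

  NullSpace : Matrix m n → Pred (Vector Carrier n) ℓ₁
  NullSpace M v = M *ᵥ v ≋ 0ᵥ

  LinearlyIndependent : Vector (Vector Carrier n) d → Set (c ⊔ ℓ₁)
  LinearlyIndependent b = ∀ x → x ᵥ* b ≋ 0ᵥ → x ≋ 0ᵥ

  record Basis {v} (V : Pred (Vector Carrier n) v) (d : ℕ) : Set (c ⊔ ℓ₁ ⊔ v) where
    field
      vectors     : Vector (Vector Carrier n) d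
      member      : ∀ i → vectors i ∈ V
      independent : LinearlyIndependent vectors
      spanning    : ∀ {w} → w ∈ V → ∃ λ x → w ≋ x ᵥ* vectors

  open Basis

  -- Every null space and every row space has a basis, so that nullity and
  -- rank can be defined as dimensions.

  private

    unit : Fin n → Vector Carrier n
    unit zero    = 1# ∷ 0ᵥ
    unit (suc i) = 0# ∷ unit i

    sum-zero : (f : Vector Carrier n) → f ≋ 0ᵥ → sum f ≈ 0#
    sum-zero {n} f f≋0 = trans (sum-cong-≋ f≋0) (sum-replicate-zero n)

    ᵥ*-unit : (a : Vector Carrier n) → a ᵥ* unit ≋ a
    ᵥ*-unit {suc n} a zero    = begin
      a zero * 1# + ∑[ i < n ] (a (suc i) * 0#)
        ≈⟨ +-cong (*-identityʳ _) (sum-zero {n} _ λ i → zeroʳ _) ⟩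
      a zero + 0#  ≈⟨ +-identityʳ _ ⟩
      a zero       ∎
    ᵥ*-unit {suc n} a (suc j) = begin
      a zero * 0# + (tail a ᵥ* unit) j  ≈⟨ +-cong (zeroʳ _) (ᵥ*-unit (tail a) j) ⟩
      0# + a (suc j)                    ≈⟨ +-identityˡ _ ⟩
      a (suc j)                         ∎

    unit-*ᵥ : (a : Vector Carrier n) → unit *ᵥ a ≋ a
    unit-*ᵥ {suc n} a zero    = begin
      1# * a zero + ∑[ i < n ] (0# * a (suc i))
        ≈⟨ +-cong (*-identityˡ _) (sum-zero {n} _ λ i → zeroˡ _) ⟩
      a zero + 0#  ≈⟨ +-identityʳ _ ⟩
      a zero       ∎
    unit-*ᵥ {suc n} a (suc j) = begin
      0# * a zero + (unit *ᵥ tail a) j  ≈⟨ +-cong (zeroˡ _) (unit-*ᵥ (tail a) j) ⟩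
      0# + a (suc j)                    ≈⟨ +-identityˡ _ ⟩
      a (suc j)                         ∎

    ᵥ*-cong : {x y : Vector Carrier m} (M : Matrix m n) → x ≋ y → x ᵥ* M ≋ y ᵥ* M
    ᵥ*-cong M x≋y j = sum-cong-≋ λ i → *-congʳ (x≋y i)

    ᵥ*-assoc : (x : Vector Carrier p) (M : Matrix p q) (N : Matrix q n) →
               x ᵥ* M ᵥ* N ≋ x ᵥ* (λ i → M i ᵥ* N)
    ᵥ*-assoc {p} {q} x M N j = begin
      ∑[ l < q ] (∑[ i < p ] (x i * M i l) * N l j)
        ≈⟨ sum-cong-≋ {q} (λ l → *-distribʳ-sum {p} (N l j) _) ⟩
      ∑[ l < q ] ∑[ i < p ] (x i * M i l * N l j)
        ≈⟨ ∑-comm {q} {p} (λ l i → x i * M i l * N l j) ⟩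
      ∑[ i < p ] ∑[ l < q ] (x i * M i l * N l j)
        ≈⟨ sum-cong-≋ {p} (λ i → sum-cong-≋ {q} λ l → *-assoc (x i) (M i l) (N l j)) ⟩
      ∑[ i < p ] ∑[ l < q ] (x i * (M i l * N l j))
        ≈⟨ sum-cong-≋ {p} (λ i → *-distribˡ-sum {q} (x i) _) ⟨
      ∑[ i < p ] (x i * ∑[ l < q ] (M i l * N l j))
        ∎

    dot-combination : (r : Vector Carrier n) (x : Vector Carrier d) (b : Matrix d n) →
                      ∑[ j < n ] (r j * (x ᵥ* b) j) ≈
                      ∑[ i < d ] (x i * ∑[ j < n ] (r j * b i j))
    dot-combination {n} {d} r x b = begin
      ∑[ j < n ] (r j * ∑[ i < d ] (x i * b i j))
        ≈⟨ sum-cong-≋ {n} (λ j → *-distribˡ-sum {d} (r j) _) ⟩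
      ∑[ j < n ] ∑[ i < d ] (r j * (x i * b i j))
        ≈⟨ ∑-comm {n} {d} (λ j i → r j * (x i * b i j)) ⟩
      ∑[ i < d ] ∑[ j < n ] (r j * (x i * b i j))
        ≈⟨ sum-cong-≋ {d} (λ i → sum-cong-≋ {n} λ j →
             trans (sym (*-assoc _ _ _)) (trans (*-congʳ (*-comm _ _)) (*-assoc _ _ _))) ⟩
      ∑[ i < d ] ∑[ j < n ] (x i * (r j * b i j))
        ≈⟨ sum-cong-≋ {d} (λ i → *-distribˡ-sum {n} (x i) _) ⟨
      ∑[ i < d ] (x i * ∑[ j < n ] (r j * b i j))
        ∎

    Orthogonal : Vector Carrier n → Pred (Vector Carrier n) ℓ₁
    Orthogonal {n} φ v = ∑[ j < n ] (v j * φ j) ≈ 0#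

    orthogonalBasis₀ : (φ : Vector Carrier n) → φ ≋ 0ᵥ → Basis (Orthogonal φ) n
    orthogonalBasis₀ φ φ≋0 = record
      { vectors     = unit
      ; member      = λ i → trans (unit-*ᵥ φ i) (φ≋0 i)
      ; independent = λ x eq i → trans (sym (ᵥ*-unit x i)) (eq i)
      ; spanning    = λ {w} _ → w , λ i → sym (ᵥ*-unit w i)
      }

    orthogonalBasis₁ : (φ : Vector Carrier (suc n)) (i : Fin (suc n)) (t : Carrier) →
                       φ i * t ≈ 1# → Basis (Orthogonal φ) n
    orthogonalBasis₁ {n} φ i t φᵢt≈1 = record
      { vectors     = T
      ; member      = member-T
      ; independent = λ x eq l → trans (sym (at-punchIn x l)) (eq (punchIn i l))
      ; spanning    = λ {w} w∈V → removeAt w i , agree w w∈V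
      }
      where
      ψ : Vector Carrier n
      ψ j = φ (punchIn i j)

      T : Matrix n (suc n)
      T j = insertAt (unit j) i (- (ψ j * t))

      at-i : ∀ x → (x ᵥ* T) i ≈ ∑[ j < n ] (x j * - (ψ j * t))
      at-i x = sum-cong-≋ λ j → *-congˡ (reflexive (insertAt-lookup (unit j) i _))

      at-punchIn : ∀ x l → (x ᵥ* T) (punchIn i l) ≈ x l
      at-punchIn x l = trans
        (sum-cong-≋ λ j → *-congˡ (reflexive (insertAt-punchIn (unit j) i _ l)))
        (ᵥ*-unit x l)

      tφᵢ≈1 : t * φ i ≈ 1#
      tφᵢ≈1 = trans (*-comm _ _) φᵢt≈1

      member-T : ∀ j → Orthogonal φ (T j)
      member-T j = begin
        ∑[ l < suc n ] (T j l * φ l)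
          ≈⟨ sum-remove {i = i} (λ l → T j l * φ l) ⟩
        T j i * φ i + ∑[ l < n ] (T j (punchIn i l) * ψ l)
          ≈⟨ +-cong (*-congʳ (reflexive (insertAt-lookup (unit j) i _)))
                    (trans (sum-cong-≋ λ l → *-congʳ (reflexive (insertAt-punchIn (unit j) i _ l)))
                           (unit-*ᵥ ψ j)) ⟩
        - (ψ j * t) * φ i + ψ j
          ≈⟨ +-congʳ (-‿distribˡ-* _ _) ⟨
        - (ψ j * t * φ i) + ψ j
          ≈⟨ +-congʳ (-‿cong (trans (*-assoc _ _ _) (trans (*-congˡ tφᵢ≈1) (*-identityʳ _)))) ⟩
        - ψ j + ψ j
          ≈⟨ -‿inverseˡ _ ⟩
        0# ∎

      agree : ∀ w → Orthogonal φ w → w ≋ removeAt w i ᵥ* T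
      agree w w∈V l with i ≟ᶠ l
      ... | no i≢l = begin
        w l                                              ≡⟨ ≡.cong w (punchIn-punchOut i≢l) ⟨
        w (punchIn i (punchOut i≢l))                     ≈⟨ at-punchIn (removeAt w i) _ ⟨
        (removeAt w i ᵥ* T) (punchIn i (punchOut i≢l))   ≡⟨ ≡.cong (removeAt w i ᵥ* T) (punchIn-punchOut i≢l) ⟩
        (removeAt w i ᵥ* T) l                            ∎
      ... | yes ≡.refl = sym (begin
        (removeAt w i ᵥ* T) i
          ≈⟨ at-i (removeAt w i) ⟩
        ∑[ j < n ] (w (punchIn i j) * - (ψ j * t))
          ≈⟨ sum-cong-≋ {n} (λ j → trans (*-congˡ (-‿distribʳ-* _ _)) (sym (*-assoc _ _ _))) ⟩
        ∑[ j < n ] (w (punchIn i j) * ψ j * - t)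
          ≈⟨ *-distribʳ-sum {n} (- t) _ ⟨
        S * - t
          ≈⟨ -‿distribʳ-* _ _ ⟨
        - (S * t)
          ≈⟨ inverseʳ-unique (S * t) (w i) St+wᵢ≈0 ⟨
        w i ∎)
        where
        S = ∑[ j < n ] (w (punchIn i j) * ψ j)
        St+wᵢ≈0 : S * t + w i ≈ 0#
        St+wᵢ≈0 = begin
          S * t + w i              ≈⟨ +-congˡ (*-identityʳ _) ⟨
          S * t + w i * 1#         ≈⟨ +-congˡ (*-congˡ φᵢt≈1) ⟨
          S * t + w i * (φ i * t)  ≈⟨ +-congˡ (*-assoc _ _ _) ⟨
          S * t + w i * φ i * t    ≈⟨ distribʳ _ _ _ ⟨
          (S + w i * φ i) * t      ≈⟨ *-congʳ (+-comm _ _) ⟩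
          (w i * φ i + S) * t      ≈⟨ *-congʳ (sum-remove {i = i} (λ l → w l * φ l)) ⟨
          ∑[ l < suc n ] (w l * φ l) * t ≈⟨ *-congʳ w∈V ⟩
          0# * t                   ≈⟨ zeroˡ t ⟩
          0#                       ∎

    nonzero? : (φ : Vector Carrier n) → Dec (∃ λ i → ¬ φ i ≈ 0#)
    nonzero? φ = any? λ i → ¬? (φ i ≟ 0#)

    all-zero : (φ : Vector Carrier n) → ¬ (∃ λ i → ¬ φ i ≈ 0#) → φ ≋ 0ᵥ
    all-zero φ ∄ i = decidable-stable (φ i ≟ 0#) λ φᵢ≉0 → ∄ (i , φᵢ≉0)

    orthogonalBasis : (φ : Vector Carrier n) → ∃ (Basis (Orthogonal φ))
    orthogonalBasis {n} φ with nonzero? φ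
    orthogonalBasis {n} φ | no ∄ = n , orthogonalBasis₀ φ (all-zero φ ∄)
    orthogonalBasis {suc n} φ | yes (i , φᵢ≉0) =
      let t , φᵢt≈1 = inverse (φ i) φᵢ≉0 in n , orthogonalBasis₁ φ i t φᵢt≈1

    nullSpaceStep : (M : Matrix (suc m) n) → Basis (NullSpace (tail M)) d →
                    ∃ (Basis (NullSpace M))
    nullSpaceStep {n = n} {d = d} M B = proj₁ ob , record
      { vectors     = λ i → vectors T i ᵥ* b
      ; member      = λ where
          i zero    → trans (dot-combination r (vectors T i) b) (member T i)
          i (suc l) → trans (dot-combination (M (suc l)) (vectors T i) b)
                            (sum-zero _ λ j → trans (*-congˡ (member B j l)) (zeroʳ _))
      ; independent = λ x eq → independent T x (independent B (x ᵥ* vectors T)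
                        λ j → trans (ᵥ*-assoc x (vectors T) b j) (eq j))
      ; spanning    = spans
      }
      where
      b  = vectors B
      r  = head M
      φ : Vector Carrier d
      φ i = ∑[ j < n ] (r j * b i j)
      ob = orthogonalBasis φ
      T  = proj₂ ob
      spans : ∀ {w} → w ∈ NullSpace M → ∃ λ x → w ≋ x ᵥ* (λ i → vectors T i ᵥ* b)
      spans {w} w∈N =
        let a , w≋ab = spanning B (λ l → w∈N (suc l))
            e , a≋eT = spanning T (begin
              ∑[ i < d ] (a i * φ i)       ≈⟨ dot-combination r a b ⟨
              ∑[ j < n ] (r j * (a ᵥ* b) j) ≈⟨ sum-cong-≋ (λ j → *-congˡ (w≋ab j)) ⟨
              ∑[ j < n ] (r j * w j)       ≈⟨ w∈N zero ⟩
              0#                           ∎)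
        in e , λ j → trans (w≋ab j)
                       (trans (ᵥ*-cong b a≋eT j) (ᵥ*-assoc e (vectors T) b j))

  abstract

    nullSpaceBasis : (M : Matrix m n) → ∃ (Basis (NullSpace M))
    nullSpaceBasis {zero} {n} M = n , record
      { vectors     = unit
      ; member      = λ _ ()
      ; independent = λ x eq i → trans (sym (ᵥ*-unit x i)) (eq i)
      ; spanning    = λ {w} _ → w , λ i → sym (ᵥ*-unit w i)
      }
    nullSpaceBasis {suc m} M = nullSpaceStep M (proj₂ (nullSpaceBasis (tail M)))

  private

    rowSpaceStep : (M : Matrix (suc m) n) → Basis (RS (tail M)) d → ∃ (Basis (RS M))
    rowSpaceStep {n = n} {d = d} M B = extend (nonzero? κ₀)
      where
      b = vectors B
      r = head M

      rb : Matrix (suc d) n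
      rb = r ∷ b

      -- The linear relations between r and the vectors of b.
      K = proj₂ (nullSpaceBasis (rb ᵀ))
      κ = vectors K

      κ₀ : Vector Carrier (proj₁ (nullSpaceBasis (rb ᵀ)))
      κ₀ i = κ i zero

      relation : ∀ x → x ᵥ* rb ≋ 0ᵥ → x ∈ NullSpace (rb ᵀ)
      relation x eq j = trans (sum-cong-≋ λ i → *-comm (rb i j) (x i)) (eq j)

      tail∈RS : ∀ {w} → w ∈ RS (tail M) → w ∈ RS M
      tail∈RS (y , w≋) = 0# ∷ y , λ j →
        trans (w≋ j) (sym (trans (+-congʳ (zeroˡ _)) (+-identityˡ _)))

      member-b : ∀ i → b i ∈ RS M
      member-b i = tail∈RS (member B i)

      -- A vector of RS M as a combination of r and the vectors of b.
      split : ∀ {w} → ((y , _) : w ∈ RS M) → ∃ λ a → ∀ j → w j ≈ y zero * r j + (a ᵥ* b) j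
      split (y , w≋) =
        let a , y′M≋ab = spanning B (tail y , λ _ → refl)
        in a , λ j → trans (w≋ j) (+-congˡ (y′M≋ab j))

      extend : Dec (∃ λ i → ¬ κ₀ i ≈ 0#) → ∃ (Basis (RS M))
      extend (no ∄) = suc d , record
        { vectors     = rb
        ; member      = λ where
            zero    → unit zero , λ j → sym (trans
                        (+-cong (*-identityˡ _) (sum-zero (λ i → 0# * M (suc i) j) λ i → zeroˡ _)) (+-identityʳ _))
            (suc i) → member-b i
        ; independent = indep
        ; spanning    = λ w∈RS → let a , w≋ = split w∈RS in proj₁ w∈RS zero ∷ a , w≋
        }
        where
        indep : LinearlyIndependent rb
        indep x eq = λ where
            zero    → x₀≈0
            (suc i) → independent B (tail x) (λ j → begin
              (tail x ᵥ* b) j                 ≈⟨ +-identityˡ _ ⟨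
              0# + (tail x ᵥ* b) j            ≈⟨ +-congʳ (trans (*-congʳ x₀≈0) (zeroˡ _)) ⟨
              x zero * r j + (tail x ᵥ* b) j  ≈⟨ eq j ⟩
              0#                              ∎) i
          where
          x₀≈0 : x zero ≈ 0#
          x₀≈0 = let e , x≋eκ = spanning K {x} (relation x eq) in
            trans (x≋eκ zero)
              (sum-zero _ λ i → trans (*-congˡ (all-zero κ₀ ∄ i)) (zeroʳ _))
      extend (yes (i , x₀≉0)) = d , record
        { vectors     = b
        ; member      = member-b
        ; independent = independent B
        ; spanning    = λ w∈RS → let a , w≋ = split w∈RS ; y₀ = proj₁ w∈RS zero in
            (λ l → y₀ * s l + a l) , λ j → begin
              _                                       ≈⟨ w≋ j ⟩
              y₀ * r j + (a ᵥ* b) j                   ≈⟨ +-congʳ (*-congˡ (r≋sb j)) ⟩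
              y₀ * (s ᵥ* b) j + (a ᵥ* b) j            ≈⟨ +-congʳ (*-distribˡ-sum {d} y₀ (λ l → s l * b l j)) ⟩
              ∑[ l < d ] (y₀ * (s l * b l j)) + (a ᵥ* b) j
                ≈⟨ ∑-distrib-+ {d} (λ l → y₀ * (s l * b l j)) (λ l → a l * b l j) ⟨
              ∑[ l < d ] (y₀ * (s l * b l j) + a l * b l j)
                ≈⟨ sum-cong-≋ {d} (λ l → trans (distribʳ _ _ _) (+-congʳ (*-assoc _ _ _))) ⟨
              ∑[ l < d ] ((y₀ * s l + a l) * b l j)   ∎
        }
        where
        x = κ i
        t = proj₁ (inverse (x zero) x₀≉0)
        x₀t≈1 = proj₂ (inverse (x zero) x₀≉0)

        s : Vector Carrier d
        s l = - t * x (suc l)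

        r≋sb : r ≋ s ᵥ* b
        r≋sb j = begin
          r j                     ≈⟨ *-identityˡ _ ⟨
          1# * r j                ≈⟨ *-congʳ (trans (*-comm _ _) x₀t≈1) ⟨
          t * x zero * r j        ≈⟨ *-assoc _ _ _ ⟩
          t * (x zero * r j)      ≈⟨ inverseʳ-unique _ _ cancel ⟩
          - (t * (tail x ᵥ* b) j) ≈⟨ -‿distribˡ-* _ _ ⟩
          - t * (tail x ᵥ* b) j   ≈⟨ *-distribˡ-sum {d} (- t) _ ⟩
          ∑[ l < d ] (- t * (x (suc l) * b l j)) ≈⟨ sum-cong-≋ {d} (λ l → *-assoc _ _ _) ⟨
          (s ᵥ* b) j              ∎
          where
          cancel : t * (tail x ᵥ* b) j + t * (x zero * r j) ≈ 0#
          cancel = begin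
            t * (tail x ᵥ* b) j + t * (x zero * r j)  ≈⟨ distribˡ _ _ _ ⟨
            t * ((tail x ᵥ* b) j + x zero * r j)      ≈⟨ *-congˡ (+-comm _ _) ⟩
            t * (x zero * r j + (tail x ᵥ* b) j)
              ≈⟨ *-congˡ (trans (sum-cong-≋ λ l → *-comm (x l) (rb l j)) (member K i j)) ⟩
            t * 0#                                    ≈⟨ zeroʳ t ⟩
            0#                                        ∎

  abstract

    rowSpaceBasis : (M : Matrix m n) → ∃ (Basis (RS M))
    rowSpaceBasis {zero} M = 0 , record
      { vectors     = M
      ; member      = λ ()
      ; independent = λ _ _ ()
      ; spanning    = λ w∈RS → w∈RS
      }
    rowSpaceBasis {suc m} M = rowSpaceStep M (proj₂ (rowSpaceBasis (tail M)))

  nullity : Matrix m n → ℕ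
  nullity M = proj₁ (nullSpaceBasis M)

  rank : Matrix m n → ℕ
  rank M = proj₁ (rowSpaceBasis M)

  -- The increasing enumeration of the elements outside α.
  outsiders : (α : Subset n) → Vector (Fin n) ∣ ∁ α ∣
  outsiders (inside  Vec.∷ α) i       = suc (outsiders α i)
  outsiders (outside Vec.∷ α) zero    = zero
  outsiders (outside Vec.∷ α) (suc i) = suc (outsiders α i)

  -- A ⟨ α ⟩ deletes the rows and columns indexed by α.
  infix 9 _⟨_⟩
  _⟨_⟩ : Matrix n n → (α : Subset n) → Matrix ∣ ∁ α ∣ ∣ ∁ α ∣
  (A ⟨ α ⟩) i j = A (outsiders α i) (outsiders α j)

  PSet : Matrix n n → Subset n → Set
  PSet A α = nullity (A ⟨ α ⟩) ≡ nullity A ℕ.+ ∣ α ∣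

  firstIndices : ∀ k m → Subset (k ℕ.+ m)
  firstIndices k m = Subset.⊤ {k} Vec.++ Subset.⊥ {m}

{-# OPTIONS --safe #-}
-- By rank–nullity (for which the dot product being positive definite suffices:
-- RS M and the null space of M meet only in 0), (a) and (b) are rearrangements
-- of each other. For (b) ⇔ (c), let the rows of T be those of C followed by a
-- basis of RS D; then (c) says that T is linearly independent. A vector (u , v)
-- of RS A is determined by u and by coefficients of v in T, so
-- rank A ≤ k + (k + rank D), strictly when T has a nontrivial relation.
-- Conversely, if (x , y) is in the null space of A then xᵀC = -yᵀD, so (c)
-- forces x = 0 and makes y orthogonal to T, whence
-- nullity A + (k + rank D) ≤ m.
module Submission where

open import Defs
open import Algebra.Bundles using (CommutativeRing)
open import Data.Empty using (⊥-elim)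
open import Data.Fin.Base using (Fin; zero; suc; toℕ; cast; punchOut; _↑ˡ_; _↑ʳ_)
open import Data.Fin.Properties
  using (any?; punchIn-punchOut; toℕ-injective; toℕ-cast; toℕ-↑ʳ; cast-is-id)
  renaming (_≟_ to _≟ᶠ_)
open import Data.Fin.Subset using (∣_∣; ∁)
open import Data.Fin.Subset.Properties using (∣⊥∣≡0; ∣∁p∣≡n∸∣p∣)
open import Data.Nat.Base as ℕ using (ℕ; zero; suc; _+_; _*_; _≤_; z≤n; s≤s)
import Data.Nat.Properties as ℕₚ
open import Data.Nat.Tactic.RingSolver using (solve-∀)
open import Data.Product.Base using (∃; _×_; _,_; proj₁; proj₂)
open import Data.Sum.Base using (_⊎_; inj₁; inj₂)
open import Data.Vec.Functional using (Vector; tail; removeAt; take; drop; _∷_; _++_)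
open import Data.Vec.Functional.Properties using (lookup-++ˡ; lookup-++ʳ)
open import Function.Bundles using (_⇔_; mk⇔)
open import Function.Construct.Composition using (_⇔-∘_)
open import Level using (Level)
open import Relation.Binary.Definitions using (tri<; tri≈; tri>)
open import Relation.Binary.PropositionalEquality as ≡ using (_≡_)
open import Relation.Binary.Structures using (IsStrictTotalOrder)
open import Relation.Nullary using (¬_; yes; no)
open import Relation.Nullary.Decidable using (¬?; decidable-stable)
open import Relation.Unary using (Pred; _∈_; _⊆_; _≐_)

-- Arithmetic of ranks and nullities

complement-≤ : ∀ a k s {r m} → a + r ≡ k + m → a + s ≤ m → k + s ≤ r
complement-≤ a k s {r} {m} a+r≡k+m a+s≤m = ℕₚ.+-cancelˡ-≤ a _ _ (begin
  a + (k + s)  ≡⟨ x+[y+z]≡y+[x+z] a k s ⟩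
  k + (a + s)  ≤⟨ ℕₚ.+-monoʳ-≤ k a+s≤m ⟩
  k + m        ≡⟨ a+r≡k+m ⟨
  a + r        ∎)
  where
  open ℕₚ.≤-Reasoning
  x+[y+z]≡y+[x+z] : ∀ x y z → x + (y + z) ≡ y + (x + z)
  x+[y+z]≡y+[x+z] = solve-∀

-- Here `a` and `r` stand for the nullity and rank of `A`, and `d` and `s` for those of `D`.
-- Eliminating `m` from the two rank-nullity equations leaves a + r = k + d + s, which carries each
-- of the two equations into the other by cancellation.
complement-≡-⇔ : ∀ a d k {r s m} → a + r ≡ k + m → d + s ≡ m →
                 d ≡ a + k ⇔ r ≡ s + 2 * k
complement-≡-⇔ a d k {r} {s} {m} a+r≡k+m d+s≡m = mk⇔
  (λ d≡a+k → ℕₚ.+-cancelˡ-≡ a _ _ (begin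
    a + r            ≡⟨ a+r≡k+[d+s] ⟩
    k + (d + s)      ≡⟨ ≡.cong (λ x → k + (x + s)) d≡a+k ⟩
    k + (a + k + s)  ≡⟨ rearrange a k s ⟩
    a + (s + 2 * k)  ∎))
  (λ r≡s+2k → ℕₚ.+-cancelʳ-≡ s _ _ (ℕₚ.+-cancelˡ-≡ k _ _ (begin
    k + (d + s)      ≡⟨ a+r≡k+[d+s] ⟨
    a + r            ≡⟨ ≡.cong (a +_) r≡s+2k ⟩
    a + (s + 2 * k)  ≡⟨ rearrange a k s ⟨
    k + (a + k + s)  ∎)))
  where
  open ≡.≡-Reasoning
  a+r≡k+[d+s] : a + r ≡ k + (d + s)
  a+r≡k+[d+s] = ≡.trans a+r≡k+m (≡.cong (k +_) (≡.sym d+s≡m))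
  rearrange : ∀ a k s → k + (a + k + s) ≡ a + (s + 2 * k)
  rearrange = solve-∀

module LinearAlgebra {c ℓ₁ ℓ₂ : Level} (ℝ : RealNumbers c ℓ₁ ℓ₂) where

  open RealNumbers ℝ using (_<_; 1≉0; inverse; isStrictTotalOrder; +-monoʳ-<; *-pos)
  open CommutativeRing (RealNumbers.commutativeRing ℝ) hiding (zero; _+_; _*_)
    renaming (+-cong to ⊕-cong; +-congˡ to ⊕-congˡ; +-congʳ to ⊕-congʳ)
  open CommutativeRing (RealNumbers.commutativeRing ℝ) using ()
    renaming (_+_ to infixl 6 _⊕_; _*_ to infixl 7 _⊗_)
  open IsStrictTotalOrder isStrictTotalOrder
    using (_≟_; compare; irrefl; <-respˡ-≈; <-respʳ-≈)
    renaming (trans to <-trans)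
  open import Algebra.Properties.Semiring.Sum semiring
  open import Algebra.Properties.Ring ring using (-‿distribˡ-*; -‿distribʳ-*; -1*x≈-x)
  open import Algebra.Properties.AbelianGroup +-abelianGroup
    using (inverseˡ-unique) renaming (⁻¹-involutive to -‿involutive)
  open import Relation.Binary.Reasoning.Setoid setoid
  open RealMatrices ℝ
  open Basis

  private
    variable
      d d′ e k m n p q : ℕ

  -- The dot product and matrix products

  infixl 7 _·_
  _·_ : Vector Carrier n → Vector Carrier n → Carrier
  _·_ {n} u v = ∑[ j < n ] (u j ⊗ v j)

  ·-comm : (u v : Vector Carrier n) → u · v ≈ v · u
  ·-comm u v = sum-cong-≋ λ j → *-comm (u j) (v j)

  ·-cong : {u u′ v v′ : Vector Carrier n} → u ≋ u′ → v ≋ v′ → u · v ≈ u′ · v′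
  ·-cong u≋ v≋ = sum-cong-≋ λ j → *-cong (u≋ j) (v≋ j)

  ·-zeroʳ : (u : Vector Carrier n) {v : Vector Carrier n} → v ≋ 0ᵥ → u · v ≈ 0#
  ·-zeroʳ {n} u v≋0 =
    trans (sum-cong-≋ λ j → trans (*-congˡ (v≋0 j)) (zeroʳ (u j))) (sum-replicate-zero n)

  ·-zeroˡ : {u : Vector Carrier n} (v : Vector Carrier n) → u ≋ 0ᵥ → u · v ≈ 0#
  ·-zeroˡ {u = u} v u≋0 = trans (·-comm u v) (·-zeroʳ v u≋0)

  ·-distribˡ : (u v w : Vector Carrier n) → u · (λ j → v j ⊕ w j) ≈ u · v ⊕ u · w
  ·-distribˡ u v w = trans (sum-cong-≋ λ j → distribˡ (u j) (v j) (w j))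
    (∑-distrib-+ (λ j → u j ⊗ v j) (λ j → u j ⊗ w j))

  ·-scaleʳ : (u v : Vector Carrier n) (a : Carrier) → u · (λ j → v j ⊗ a) ≈ (u · v) ⊗ a
  ·-scaleʳ u v a = sym (trans (*-distribʳ-sum a (λ j → u j ⊗ v j))
    (sum-cong-≋ λ j → *-assoc (u j) (v j) a))

  ·-scaleˡ : (a : Carrier) (u v : Vector Carrier n) → (λ j → a ⊗ u j) · v ≈ a ⊗ (u · v)
  ·-scaleˡ a u v = sym (trans (*-distribˡ-sum a (λ j → u j ⊗ v j))
    (sum-cong-≋ λ j → sym (*-assoc a (u j) (v j))))

  -- Both sides expand to the same double sum, summed in different orders. With a column of a second
  -- matrix as `y`, this is associativity.
  ·-adjoint : (x : Vector Carrier p) (M : Matrix p q) (y : Vector Carrier q) →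
              (x ᵥ* M) · y ≈ x · (M *ᵥ y)
  ·-adjoint {p} {q} x M y = begin
    ∑[ l < q ] (∑[ i < p ] (x i ⊗ M i l) ⊗ y l)
      ≈⟨ sum-cong-≋ {q} (λ l → *-distribʳ-sum {p} (y l) _) ⟩
    ∑[ l < q ] ∑[ i < p ] (x i ⊗ M i l ⊗ y l)
      ≈⟨ ∑-comm {q} {p} (λ l i → x i ⊗ M i l ⊗ y l) ⟩
    ∑[ i < p ] ∑[ l < q ] (x i ⊗ M i l ⊗ y l)
      ≈⟨ sum-cong-≋ {p} (λ i → sum-cong-≋ {q} λ l → *-assoc (x i) (M i l) (y l)) ⟩
    ∑[ i < p ] ∑[ l < q ] (x i ⊗ (M i l ⊗ y l))
      ≈⟨ sum-cong-≋ {p} (λ i → *-distribˡ-sum {q} (x i) _) ⟨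
    x · (M *ᵥ y) ∎

  ᵥ*-assoc : (x : Vector Carrier p) (M : Matrix p q) (N : Matrix q n) →
             x ᵥ* M ᵥ* N ≋ x ᵥ* (λ i → M i ᵥ* N)
  ᵥ*-assoc x M N j = ·-adjoint x M ((N ᵀ) j)

  ᵥ*-congˡ : (x : Vector Carrier p) {M N : Matrix p q} → (∀ i → M i ≋ N i) → x ᵥ* M ≋ x ᵥ* N
  ᵥ*-congˡ x M≋N j = sum-cong-≋ λ i → *-congˡ (M≋N i j)

  -ᵥ : Vector Carrier n → Vector Carrier n
  -ᵥ x i = - 1# ⊗ x i

  -ᵥ-ᵥ* : (x : Vector Carrier p) (M : Matrix p q) (j : Fin q) →
          (-ᵥ x ᵥ* M) j ≈ - (x ᵥ* M) j
  -ᵥ-ᵥ* x M j = trans (·-scaleˡ (- 1#) x ((M ᵀ) j)) (-1*x≈-x _)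

  ≋0⊎∃≉0 : (v : Vector Carrier n) → v ≋ 0ᵥ ⊎ (∃ λ i → ¬ v i ≈ 0#)
  ≋0⊎∃≉0 v with any? (λ i → ¬? (v i ≟ 0#))
  ... | yes ∃i = inj₂ ∃i
  ... | no  ∄i = inj₁ λ i → decidable-stable (v i ≟ 0#) λ vᵢ≉0 → ∄i (i , vᵢ≉0)

  *-nonzeroʳ : ∀ {x y} → ¬ y ≈ 0# → x ⊗ y ≈ 0# → x ≈ 0#
  *-nonzeroʳ {x} {y} y≉0 xy≈0 = let t , yt≈1 = inverse y y≉0 in begin
    x            ≈⟨ *-identityʳ x ⟨
    x ⊗ 1#       ≈⟨ *-congˡ yt≈1 ⟨
    x ⊗ (y ⊗ t)  ≈⟨ *-assoc x y t ⟨
    x ⊗ y ⊗ t    ≈⟨ *-congʳ xy≈0 ⟩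
    0# ⊗ t       ≈⟨ zeroˡ t ⟩
    0#           ∎

  -- Concatenation

  sum-take-drop : ∀ k (f : Vector Carrier (k + n)) →
                  sum f ≈ sum (take k f) ⊕ sum (drop k f)
  sum-take-drop zero    f = sym (+-identityˡ _)
  sum-take-drop (suc k) f =
    trans (⊕-congˡ (sum-take-drop k (tail f))) (sym (+-assoc _ _ _))

  ≋0-take-drop : ∀ k {v : Vector Carrier (k + n)} → take k v ≋ 0ᵥ → drop k v ≋ 0ᵥ → v ≋ 0ᵥ
  ≋0-take-drop zero    t≋0 d≋0 i       = d≋0 i
  ≋0-take-drop (suc k) t≋0 d≋0 zero    = t≋0 zero
  ≋0-take-drop (suc k) t≋0 d≋0 (suc i) = ≋0-take-drop k (λ j → t≋0 (suc j)) d≋0 i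

  ᵥ*-++ : (x : Vector Carrier (p + q)) (M : Matrix p n) (N : Matrix q n) (j : Fin n) →
          (x ᵥ* (M ++ N)) j ≈ (take p x ᵥ* M) j ⊕ (drop p x ᵥ* N) j
  ᵥ*-++ {p} x M N j = trans (sum-take-drop p _) (⊕-cong
    (sum-cong-≋ λ i → *-congˡ (reflexive (≡.cong (λ r → r j) (lookup-++ˡ M N i))))
    (sum-cong-≋ λ i → *-congˡ (reflexive (≡.cong (λ r → r j) (lookup-++ʳ M N i)))))

  ++-ᵥ*-++ : (x : Vector Carrier p) (y : Vector Carrier q)
             (M : Matrix p n) (N : Matrix q n) (j : Fin n) →
             ((x ++ y) ᵥ* (M ++ N)) j ≈ (x ᵥ* M) j ⊕ (y ᵥ* N) j
  ++-ᵥ*-++ x y M N j = trans (ᵥ*-++ (x ++ y) M N j) (⊕-cong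
    (sum-cong-≋ λ i → *-congʳ (reflexive (lookup-++ˡ x y i)))
    (sum-cong-≋ λ i → *-congʳ (reflexive (lookup-++ʳ x y i))))

  ++-· : (u : Vector Carrier p) (v : Vector Carrier q) (z : Vector Carrier (p + q)) →
         (u ++ v) · z ≈ u · take p z ⊕ v · drop p z
  ++-· {p} u v z = trans (sum-take-drop p _) (⊕-cong
    (sum-cong-≋ λ i → *-congʳ (reflexive (lookup-++ˡ u v i)))
    (sum-cong-≋ λ i → *-congʳ (reflexive (lookup-++ʳ u v i))))

  NullSpace-++ : (M : Matrix p n) (N : Matrix q n) {z : Vector Carrier n} →
                 z ∈ NullSpace M → z ∈ NullSpace N → z ∈ NullSpace (M ++ N)
  NullSpace-++ {p} M N {z} z∈M z∈N = ≋0-take-drop p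
    (λ i → trans (reflexive (≡.cong (_· z) (lookup-++ˡ M N i))) (z∈M i))
    (λ i → trans (reflexive (≡.cong (_· z) (lookup-++ʳ M N i))) (z∈N i))

  -- Products with a block matrix

  module _ (P : Matrix p m) (Q : Matrix p n) (R : Matrix q m) (S : Matrix q n) where

    block-*ᵥ-↑ˡ : (z : Vector Carrier (m + n)) (i : Fin p) →
      (block P Q R S *ᵥ z) (i ↑ˡ q) ≈ (P *ᵥ take m z) i ⊕ (Q *ᵥ drop m z) i
    block-*ᵥ-↑ˡ z i =
      trans (reflexive (≡.cong (_· z) (lookup-++ˡ (λ l → P l ++ Q l) _ i))) (++-· (P i) (Q i) z)

    block-*ᵥ-↑ʳ : (z : Vector Carrier (m + n)) (i : Fin q) →
      (block P Q R S *ᵥ z) (p ↑ʳ i) ≈ (R *ᵥ take m z) i ⊕ (S *ᵥ drop m z) i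
    block-*ᵥ-↑ʳ z i =
      trans (reflexive (≡.cong (_· z) (lookup-++ʳ (λ l → P l ++ Q l) _ i))) (++-· (R i) (S i) z)

    ᵥ*-block-↑ʳ : (x : Vector Carrier (p + q)) (j : Fin n) →
      (x ᵥ* block P Q R S) (m ↑ʳ j) ≈ (take p x ᵥ* Q) j ⊕ (drop p x ᵥ* S) j
    ᵥ*-block-↑ʳ x j = trans (ᵥ*-++ x (λ l → P l ++ Q l) (λ l → R l ++ S l) (m ↑ʳ j)) (⊕-cong
      (sum-cong-≋ λ i → *-congˡ (reflexive (lookup-++ʳ (P i) (Q i) j)))
      (sum-cong-≋ λ i → *-congˡ (reflexive (lookup-++ʳ (R i) (S i) j))))

    block-↑ʳ-↑ʳ : ∀ i j → block P Q R S (p ↑ʳ i) (m ↑ʳ j) ≡ S i j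
    block-↑ʳ-↑ʳ i j = ≡.trans
      (≡.cong (λ r → r (m ↑ʳ j)) (lookup-++ʳ (λ l → P l ++ Q l) _ i))
      (lookup-++ʳ (R i) (S i) j)

  -- Positive definiteness of the dot product

  square-pos : ∀ {x} → ¬ x ≈ 0# → 0# < x ⊗ x
  square-pos {x} x≉0 with compare x 0#
  ... | tri≈ _ x≈0 _ = ⊥-elim (x≉0 x≈0)
  ... | tri> _ _ 0<x = *-pos 0<x 0<x
  ... | tri< x<0 _ _ = <-respʳ-≈ -x*-x≈x*x (*-pos 0<-x 0<-x)
    where
    0<-x : 0# < - x
    0<-x = <-respˡ-≈ (-‿inverseˡ x) (<-respʳ-≈ (+-identityʳ (- x)) (+-monoʳ-< (- x) x<0))
    -x*-x≈x*x : - x ⊗ - x ≈ x ⊗ x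
    -x*-x≈x*x = begin
      - x ⊗ - x      ≈⟨ -‿distribˡ-* x (- x) ⟨
      - (x ⊗ - x)    ≈⟨ -‿cong (-‿distribʳ-* x x) ⟨
      - - (x ⊗ x)    ≈⟨ -‿involutive (x ⊗ x) ⟩
      x ⊗ x          ∎

  -- The induction carries strict positivity rather than definiteness: a vanishing sum says nothing
  -- about its summands until their signs are known.
  ≋0⊎·-pos : (v : Vector Carrier n) → v ≋ 0ᵥ ⊎ 0# < v · v
  ≋0⊎·-pos {zero}  v = inj₁ λ ()
  ≋0⊎·-pos {suc n} v with v zero ≟ 0# | ≋0⊎·-pos (tail v)
  ... | yes v₀≈0 | inj₁ t≋0 = inj₁ λ where
    zero    → v₀≈0
    (suc i) → t≋0 i
  ... | yes v₀≈0 | inj₂ 0<t = inj₂ (<-respʳ-≈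
    (sym (trans (⊕-congʳ (trans (*-congˡ v₀≈0) (zeroʳ _))) (+-identityˡ _))) 0<t)
  ... | no  v₀≉0 | inj₁ t≋0 = inj₂ (<-respʳ-≈
    (sym (trans (⊕-congˡ (·-zeroʳ (tail v) t≋0)) (+-identityʳ _))) (square-pos v₀≉0))
  ... | no  v₀≉0 | inj₂ 0<t = inj₂ (<-trans (square-pos v₀≉0)
    (<-respˡ-≈ (+-identityʳ _) (+-monoʳ-< (v zero ⊗ v zero) 0<t)))

  ·-definite : (v : Vector Carrier n) → v · v ≈ 0# → v ≋ 0ᵥ
  ·-definite v v·v≈0 with ≋0⊎·-pos v
  ... | inj₁ v≋0   = v≋0
  ... | inj₂ 0<v·v = ⊥-elim (irrefl (sym v·v≈0) 0<v·v)

  -- Dimension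

  -- Gaussian elimination. Independence gives the first vector a nonzero entry `i`. Clearing that
  -- entry from the other vectors and deleting the coordinate leaves one vector and one coordinate
  -- fewer, still independent.
  independent⇒≤ : {b : Matrix d n} → LinearlyIndependent b → d ≤ n
  independent⇒≤ {zero} _ = z≤n
  independent⇒≤ {suc d} {n} {b} ind with ≋0⊎∃≉0 (b zero)
  ... | inj₁ b₀≋0 = ⊥-elim (1≉0 (ind (1# ∷ 0ᵥ) (λ j → begin
      1# ⊗ b zero j ⊕ (0ᵥ ᵥ* tail b) j
        ≈⟨ ⊕-cong (trans (*-congˡ (b₀≋0 j)) (zeroʳ 1#)) (·-zeroˡ ((tail b ᵀ) j) λ _ → refl) ⟩
      0# ⊕ 0#
        ≈⟨ +-identityʳ 0# ⟩
      0# ∎) zero))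
  independent⇒≤ {suc d} {suc n} {b} ind | inj₂ (i , b₀ᵢ≉0) =
    s≤s (independent⇒≤ {b = λ j → removeAt (h j) i} λ x eq j →
      -- A relation `x` among the cleared rows is one among the rows of `b`; the coefficient `x · g`
      -- collects the multiples of `b zero` used in clearing.
      ind ((x · g) ∷ x) (λ l → trans (combine x l) (vanish x eq l)) (suc j))
    where
    t = proj₁ (inverse (b zero i) b₀ᵢ≉0)
    g : Vector Carrier d
    g j = - (b (suc j) i ⊗ t)

    -- Row b (suc j), with entry i cleared by a multiple of row b zero.
    h : Matrix d (suc n)
    h j l = g j ⊗ b zero l ⊕ b (suc j) l

    h-i : ∀ j → h j i ≈ 0#
    h-i j = begin
      - (b (suc j) i ⊗ t) ⊗ b zero i ⊕ b (suc j) i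
        ≈⟨ ⊕-congʳ (-‿distribˡ-* _ _) ⟨
      - (b (suc j) i ⊗ t ⊗ b zero i) ⊕ b (suc j) i
        ≈⟨ ⊕-congʳ (-‿cong (trans (*-assoc _ _ _) (trans (*-congˡ
             (trans (*-comm _ _) (proj₂ (inverse (b zero i) b₀ᵢ≉0)))) (*-identityʳ _)))) ⟩
      - b (suc j) i ⊕ b (suc j) i
        ≈⟨ -‿inverseˡ _ ⟩
      0# ∎

    combine : ∀ x l → (((x · g) ∷ x) ᵥ* b) l ≈ (x ᵥ* h) l
    combine x l = sym (trans
      (·-distribˡ x (λ j → g j ⊗ b zero l) (λ j → b (suc j) l))
      (⊕-congʳ (·-scaleʳ x g (b zero l))))

    vanish : ∀ x → x ᵥ* (λ j → removeAt (h j) i) ≋ 0ᵥ → x ᵥ* h ≋ 0ᵥ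
    vanish x eq l with i ≟ᶠ l
    ... | yes ≡.refl = ·-zeroʳ x h-i
    ... | no  i≢l    = trans
      (reflexive (≡.cong (x ᵥ* h) (≡.sym (punchIn-punchOut i≢l)))) (eq (punchOut i≢l))

  -- The coefficients `X` of the vectors of `β` with respect to `β′` are independent vectors of
  -- length `d′`, since any relation among them is also a relation among the vectors of `β`.
  Basis-⊆⇒≤ : ∀ {v v′} {V : Pred (Vector Carrier n) v} {V′ : Pred (Vector Carrier n) v′} →
              V ⊆ V′ → Basis V d → Basis V′ d′ → d ≤ d′
  Basis-⊆⇒≤ V⊆V′ β β′ = independent⇒≤ {b = X} λ x xX≋0 → independent β x λ j → begin
    (x ᵥ* vectors β) j
      ≈⟨ ᵥ*-congˡ x (λ i → proj₂ (spanning β′ (V⊆V′ (member β i)))) j ⟩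
    (x ᵥ* (λ i → X i ᵥ* vectors β′)) j
      ≈⟨ ᵥ*-assoc x X (vectors β′) j ⟨
    (x ᵥ* X ᵥ* vectors β′) j
      ≈⟨ ·-zeroˡ _ xX≋0 ⟩
    0# ∎
    where X = λ i → proj₁ (spanning β′ (V⊆V′ (member β i)))

  -- Orthogonality and rank-nullity

  NullSpace-combination : (S : Matrix e n) (Z : Matrix d n) → (∀ i → Z i ∈ NullSpace S) →
                          ∀ x → x ᵥ* Z ∈ NullSpace S
  NullSpace-combination S Z Z∈N x i = begin
    S i · (x ᵥ* Z)    ≈⟨ ·-comm (S i) (x ᵥ* Z) ⟩
    (x ᵥ* Z) · S i    ≈⟨ ·-adjoint x Z (S i) ⟩
    x · (Z *ᵥ S i)    ≈⟨ ·-zeroʳ x (λ l → trans (·-comm (Z l) (S i)) (Z∈N l i)) ⟩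
    0#                ∎

  RS⊥NullSpace : (M : Matrix m n) {u z : Vector Carrier n} → u ∈ RS M → z ∈ NullSpace M →
                 u · z ≈ 0#
  RS⊥NullSpace M {u} {z} (y , u≋yM) z∈N = begin
    u · z           ≈⟨ ·-cong u≋yM (λ _ → refl) ⟩
    (y ᵥ* M) · z    ≈⟨ ·-adjoint y M z ⟩
    y · (M *ᵥ z)    ≈⟨ ·-zeroʳ y z∈N ⟩
    0#              ∎

  -- In a relation among the rows of `Z ++ S`, the contribution `s` of `Z` is orthogonal to the
  -- contribution of `S` and also its negative. Hence `s · s` vanishes, and the relation splits into
  -- one for `Z` and one for `S`.
  orthogonal-independent⇒≤ : {Z : Matrix d n} {S : Matrix e n} →
    LinearlyIndependent Z → LinearlyIndependent S → (∀ i → Z i ∈ NullSpace S) → d + e ≤ n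
  orthogonal-independent⇒≤ {d} {n} {e} {Z} {S} indZ indS Z∈N =
    independent⇒≤ {b = Z ++ S} independent′
    where
    independent′ : LinearlyIndependent (Z ++ S)
    independent′ x eq = ≋0-take-drop d (indZ x₁ s≋0) (indS x₂ λ j → begin
      (x₂ ᵥ* S) j             ≈⟨ +-identityˡ _ ⟨
      0# ⊕ (x₂ ᵥ* S) j        ≈⟨ ⊕-congʳ (s≋0 j) ⟨
      s j ⊕ (x₂ ᵥ* S) j       ≈⟨ s+x₂S≋0 j ⟩
      0#                      ∎)
      where
      x₁ = take d x
      x₂ = drop d x
      s  = x₁ ᵥ* Z

      s+x₂S≋0 : (λ j → s j ⊕ (x₂ ᵥ* S) j) ≋ 0ᵥ
      s+x₂S≋0 j = trans (sym (ᵥ*-++ x Z S j)) (eq j)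

      s·x₂S≈0 : s · (x₂ ᵥ* S) ≈ 0#
      s·x₂S≈0 = trans (·-comm s (x₂ ᵥ* S))
        (RS⊥NullSpace S (x₂ , λ _ → refl) (NullSpace-combination S Z Z∈N x₁))

      s≋0 : s ≋ 0ᵥ
      s≋0 = ·-definite s (begin
        s · s                             ≈⟨ +-identityʳ _ ⟨
        s · s ⊕ 0#                        ≈⟨ ⊕-congˡ s·x₂S≈0 ⟨
        s · s ⊕ s · (x₂ ᵥ* S)             ≈⟨ ·-distribˡ s s (x₂ ᵥ* S) ⟨
        s · (λ j → s j ⊕ (x₂ ᵥ* S) j)     ≈⟨ ·-zeroʳ s s+x₂S≋0 ⟩
        0#                                ∎)

  -- Bases of the null space and the row space are mutually orthogonal, which bounds the sum by `n`.
  -- For the other bound, stack both bases: the `n` columns are independent, because a vector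
  -- orthogonal to all the rows lies in the null space and is thus orthogonal to itself.
  rank-nullity : (M : Matrix m n) → nullity M + rank M ≡ n
  rank-nullity {m} {n} M = ℕₚ.≤-antisym
    (orthogonal-independent⇒≤ (independent K) (independent R)
      λ i l → RS⊥NullSpace M (member R l) (member K i))
    (independent⇒≤ {b = (vectors K ++ vectors R) ᵀ} orthogonal⇒0)
    where
    K = proj₂ (nullSpaceBasis M)
    R = proj₂ (rowSpaceBasis M)

    orthogonal⇒0 : LinearlyIndependent ((vectors K ++ vectors R) ᵀ)
    orthogonal⇒0 x eq = ·-definite x (begin
      x · x                   ≈⟨ ·-cong x≋cK (λ _ → refl) ⟩
      (c′ ᵥ* vectors K) · x   ≈⟨ ·-adjoint c′ (vectors K) x ⟩
      c′ · (vectors K *ᵥ x)   ≈⟨ ·-zeroʳ c′ x⊥K ⟩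
      0#                      ∎)
      where
      x⊥ : ∀ i → (vectors K ++ vectors R) i · x ≈ 0#
      x⊥ i = trans (·-comm _ x) (eq i)

      x⊥K : vectors K *ᵥ x ≋ 0ᵥ
      x⊥K i = trans (reflexive (≡.cong (_· x) (≡.sym (lookup-++ˡ (vectors K) (vectors R) i)))) (x⊥ _)

      x⊥R : vectors R *ᵥ x ≋ 0ᵥ
      x⊥R i = trans (reflexive (≡.cong (_· x) (≡.sym (lookup-++ʳ (vectors K) (vectors R) i)))) (x⊥ _)

      y : Vector Carrier m
      y = M *ᵥ x

      x∈NullSpace : x ∈ NullSpace M
      -- The square of `M *ᵥ x` is the product of `x` with the row-space vector `y ᵥ* M`, to which
      -- `x` is orthogonal.
      x∈NullSpace = ·-definite y (begin
        y · (M *ᵥ x)            ≈⟨ ·-adjoint y M x ⟨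
        (y ᵥ* M) · x            ≈⟨ ·-cong (proj₂ yM) (λ _ → refl) ⟩
        (proj₁ yM ᵥ* vectors R) · x ≈⟨ RS⊥NullSpace (vectors R) (proj₁ yM , λ _ → refl) x⊥R ⟩
        0#                      ∎)
        where yM = spanning R (y , λ _ → refl)

      c′   = proj₁ (spanning K x∈NullSpace)
      x≋cK = proj₂ (spanning K x∈NullSpace)

  -- Nullity is the size of one chosen basis, so entrywise `≈` does not give equality by congruence;
  -- the null spaces are compared by inclusion both ways. The `cast` allows for sizes that are equal
  -- only propositionally.
  nullity-cast : {M : Matrix n n} {N : Matrix m m} (eq : m ≡ n) →
                 (∀ i j → N i j ≈ M (cast eq i) (cast eq j)) → nullity N ≡ nullity M
  nullity-cast {M = M} {N} ≡.refl N≈M = ℕₚ.≤-antisym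
    (Basis-⊆⇒≤ (λ z∈N i → trans (sum-cong-≋ λ j → *-congʳ (sym (N≈M′ i j))) (z∈N i)) KN KM)
    (Basis-⊆⇒≤ (λ z∈M i → trans (sum-cong-≋ λ j → *-congʳ (N≈M′ i j)) (z∈M i)) KM KN)
    where
    KM = proj₂ (nullSpaceBasis M)
    KN = proj₂ (nullSpaceBasis N)
    N≈M′ : ∀ i j → N i j ≈ M i j
    N≈M′ i j = trans (N≈M i j)
      (reflexive (≡.cong₂ M (cast-is-id ≡.refl i) (cast-is-id ≡.refl j)))

  RS-complement : (M : Matrix m n) {a : Vector Carrier n} (y : Vector Carrier m) →
                  (∀ j → a j ⊕ (y ᵥ* M) j ≈ 0#) → a ∈ RS M
  RS-complement M y eq = -ᵥ y , λ j → trans (inverseˡ-unique _ _ (eq j)) (sym (-ᵥ-ᵥ* y M j))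

  -- Indices

  ∣firstIndices∣ : ∀ k m → ∣ firstIndices k m ∣ ≡ k
  ∣firstIndices∣ zero    m = ∣⊥∣≡0 m
  ∣firstIndices∣ (suc k) m = ≡.cong suc (∣firstIndices∣ k m)

  ∣∁firstIndices∣ : ∀ k m → ∣ ∁ (firstIndices k m) ∣ ≡ m
  ∣∁firstIndices∣ k m = ≡.trans (∣∁p∣≡n∸∣p∣ (firstIndices k m))
    (≡.trans (≡.cong (k + m ℕ.∸_) (∣firstIndices∣ k m)) (ℕₚ.m+n∸m≡n k m))

  toℕ-outsiders-firstIndices : ∀ k m i → toℕ (outsiders (firstIndices k m) i) ≡ k + toℕ i
  toℕ-outsiders-firstIndices zero    (suc m) zero    = ≡.refl
  toℕ-outsiders-firstIndices zero    (suc m) (suc i) =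
    ≡.cong suc (toℕ-outsiders-firstIndices zero m i)
  toℕ-outsiders-firstIndices (suc k) m       i       =
    ≡.cong suc (toℕ-outsiders-firstIndices k m i)

  -- The comparison is made under `toℕ`, which forgets the `cast`.
  outsiders-firstIndices : ∀ k m i →
    outsiders (firstIndices k m) i ≡ k ↑ʳ cast (∣∁firstIndices∣ k m) i
  outsiders-firstIndices k m i = toℕ-injective (≡.trans (toℕ-outsiders-firstIndices k m i)
    (≡.sym (≡.trans (toℕ-↑ʳ k _) (≡.cong (k +_) (toℕ-cast _ i)))))

  -- Vectors whose last coordinates lie in the span of T

  module Coordinates {b : Matrix d (k + m)} (independent-b : LinearlyIndependent b)
    (T : Matrix e m) (Y : Matrix d e) (b≋YT : ∀ i → drop k (b i) ≋ Y i ᵥ* T) where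

    coordinates : Matrix d (k + e)
    coordinates i = take k (b i) ++ Y i

    ᵥ*-coordinates-↑ˡ : ∀ x l → (x ᵥ* coordinates) (l ↑ˡ e) ≈ (x ᵥ* b) (l ↑ˡ m)
    ᵥ*-coordinates-↑ˡ x l =
      sum-cong-≋ λ i → *-congˡ (reflexive (lookup-++ˡ (take k (b i)) (Y i) l))

    ᵥ*-coordinates-↑ʳ : ∀ x l → (x ᵥ* coordinates) (k ↑ʳ l) ≈ (x ᵥ* Y) l
    ᵥ*-coordinates-↑ʳ x l =
      sum-cong-≋ λ i → *-congˡ (reflexive (lookup-++ʳ (take k (b i)) (Y i) l))

    -- Multiplying by `T` recovers the last coordinates of `x ᵥ* b`, so it is enough that `T` kills
    -- `x ᵥ* Y`. This leaves room for `x ᵥ* Y` to be a multiple of a relation of `T`.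
    coordinates-injective : ∀ x → (∀ l → (x ᵥ* coordinates) (l ↑ˡ e) ≈ 0#) →
                            x ᵥ* Y ᵥ* T ≋ 0ᵥ → x ≋ 0ᵥ
    coordinates-injective x first last = independent-b x (≋0-take-drop k
      (λ l → trans (sym (ᵥ*-coordinates-↑ˡ x l)) (first l))
      (λ j → trans (ᵥ*-congˡ x b≋YT j) (trans (sym (ᵥ*-assoc x Y T j)) (last j))))

    independent-coordinates : LinearlyIndependent coordinates
    independent-coordinates x eq = coordinates-injective x (λ l → eq (l ↑ˡ e))
      λ j → ·-zeroˡ _ λ l → trans (sym (ᵥ*-coordinates-↑ʳ x l)) (eq (k ↑ʳ l))

    -- A relation of `T` supplies an extra independent row. In a vanishing combination, `x′ ᵥ* Y` is
    -- a multiple of `t` and hence killed by `T`, so `x′` is zero by injectivity; the nonzero entry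
    -- of `t` then kills `x₀`.
    independent-relation∷coordinates : ∀ t i → ¬ t i ≈ 0# → t ᵥ* T ≋ 0ᵥ →
      LinearlyIndependent ((0ᵥ {k} ++ t) ∷ coordinates)
    independent-relation∷coordinates t i tᵢ≉0 tT≋0 x eq = λ where
        zero    → *-nonzeroʳ tᵢ≉0 (begin
          x₀ ⊗ t i                        ≈⟨ +-identityʳ _ ⟨
          x₀ ⊗ t i ⊕ 0#                   ≈⟨ ⊕-congˡ (·-zeroˡ _ x′≋0) ⟨
          x₀ ⊗ t i ⊕ (x′ ᵥ* Y) i          ≈⟨ last i ⟩
          0#                              ∎)
        (suc j) → x′≋0 j
      where
      x₀ = x zero
      x′ = tail x

      first : ∀ l → (x′ ᵥ* coordinates) (l ↑ˡ e) ≈ 0#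
      first l = begin
        (x′ ᵥ* coordinates) (l ↑ˡ e)            ≈⟨ +-identityˡ _ ⟨
        0# ⊕ (x′ ᵥ* coordinates) (l ↑ˡ e)
          ≈⟨ ⊕-congʳ (trans (*-congˡ (reflexive (lookup-++ˡ (0ᵥ {k}) t l))) (zeroʳ x₀)) ⟨
        (x ᵥ* ((0ᵥ {k} ++ t) ∷ coordinates)) (l ↑ˡ e) ≈⟨ eq (l ↑ˡ e) ⟩
        0#                                      ∎

      last : ∀ l → x₀ ⊗ t l ⊕ (x′ ᵥ* Y) l ≈ 0#
      last l = trans
        (sym (⊕-cong (*-congˡ (reflexive (lookup-++ʳ (0ᵥ {k}) t l))) (ᵥ*-coordinates-↑ʳ x′ l)))
        (eq (k ↑ʳ l))

      x′≋0 : x′ ≋ 0ᵥ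
      x′≋0 = coordinates-injective x′ first λ j → begin
        (x′ ᵥ* Y ᵥ* T) j                            ≈⟨ +-identityˡ _ ⟨
        0# ⊕ (x′ ᵥ* Y ᵥ* T) j                       ≈⟨ ⊕-congʳ (trans (*-congˡ (tT≋0 j)) (zeroʳ x₀)) ⟨
        x₀ ⊗ (t ᵥ* T) j ⊕ (x′ ᵥ* Y ᵥ* T) j          ≈⟨ ⊕-congʳ (·-scaleˡ x₀ t ((T ᵀ) j)) ⟨
        (λ l → x₀ ⊗ t l) · (T ᵀ) j ⊕ (x′ ᵥ* Y) · (T ᵀ) j
          ≈⟨ ⊕-cong (·-comm (λ l → x₀ ⊗ t l) ((T ᵀ) j)) (·-comm (x′ ᵥ* Y) ((T ᵀ) j)) ⟩
        (T ᵀ) j · (λ l → x₀ ⊗ t l) ⊕ (T ᵀ) j · (x′ ᵥ* Y)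
          ≈⟨ ·-distribˡ ((T ᵀ) j) (λ l → x₀ ⊗ t l) (x′ ᵥ* Y) ⟨
        (T ᵀ) j · (λ l → x₀ ⊗ t l ⊕ (x′ ᵥ* Y) l)    ≈⟨ ·-zeroʳ ((T ᵀ) j) last ⟩
        0#                                          ∎

  -- The symmetric block matrix

  module BlockMatrix (B : Matrix k k) (C : Matrix k m) (D : Matrix m m)
    (symmetric : Symmetric (block B C (C ᵀ) D)) where

    A : Matrix (k + m) (k + m)
    A = block B C (C ᵀ) D

    D-symmetric : Symmetric D
    D-symmetric i j = trans (reflexive (≡.sym (block-↑ʳ-↑ʳ B C (C ᵀ) D i j)))
      (trans (symmetric (k ↑ʳ i) (k ↑ʳ j)) (reflexive (block-↑ʳ-↑ʳ B C (C ᵀ) D j i)))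

    RD = proj₂ (rowSpaceBasis D)
    RA = proj₂ (rowSpaceBasis A)
    KA = proj₂ (nullSpaceBasis A)

    T : Matrix (k + rank D) m
    T = C ++ vectors RD

    Trivial : Set _
    Trivial = ∀ x → x ᵥ* C ∈ RS D → x ≋ 0ᵥ

    T-coefficients : ∀ {w} → w ∈ RS A → ∃ λ y → drop k w ≋ y ᵥ* T
    T-coefficients (q′ , w≋) =
      let a , q₂D≋aU = spanning RD (drop k q′ , λ _ → refl)
      in take k q′ ++ a , λ j → begin
        _                                               ≈⟨ w≋ (k ↑ʳ j) ⟩
        (q′ ᵥ* A) (k ↑ʳ j)                              ≈⟨ ᵥ*-block-↑ʳ B C (C ᵀ) D q′ j ⟩
        (take k q′ ᵥ* C) j ⊕ (drop k q′ ᵥ* D) j         ≈⟨ ⊕-congˡ (q₂D≋aU j) ⟩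
        (take k q′ ᵥ* C) j ⊕ (a ᵥ* vectors RD) j        ≈⟨ ++-ᵥ*-++ (take k q′) a C (vectors RD) j ⟨
        ((take k q′ ++ a) ᵥ* T) j                       ∎

    open Coordinates {k = k} (independent RA) T
      (λ i → proj₁ (T-coefficients (member RA i))) (λ i → proj₂ (T-coefficients (member RA i)))

    rank≤ : rank A ≤ k + (k + rank D)
    rank≤ = independent⇒≤ independent-coordinates

    relation⇒rank< : ∀ t i → ¬ t i ≈ 0# → t ᵥ* T ≋ 0ᵥ → rank A ℕ.< k + (k + rank D)
    relation⇒rank< t i tᵢ≉0 tT≋0 =
      -- The extra row makes `suc (rank A)` independent vectors, hence the strict inequality.
      independent⇒≤ {b = (0ᵥ {k} ++ t) ∷ coordinates}
        (independent-relation∷coordinates t i tᵢ≉0 tT≋0)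

    -- If xᵀC is a combination of the basis of RS D with coefficients `a`, then `x ++ -ᵥ a` is a
    -- relation of `T`. A nonzero entry of `x` would make it nontrivial and the rank too small.
    rank≡⇒trivial : rank A ≡ k + (k + rank D) → Trivial
    rank≡⇒trivial rank≡ x (y , xC≋yD) i = decidable-stable (x i ≟ 0#) λ xᵢ≉0 →
      let a , yD≋aU = spanning RD (y , λ _ → refl)
      in ℕₚ.<-irrefl rank≡ (relation⇒rank< (x ++ -ᵥ a) (i ↑ˡ rank D)
        (λ tᵢ≈0 → xᵢ≉0 (trans (reflexive (≡.sym (lookup-++ˡ x (-ᵥ a) i))) tᵢ≈0))
        λ j → begin
          ((x ++ -ᵥ a) ᵥ* T) j                       ≈⟨ ++-ᵥ*-++ x (-ᵥ a) C (vectors RD) j ⟩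
          (x ᵥ* C) j ⊕ (-ᵥ a ᵥ* vectors RD) j        ≈⟨ ⊕-cong (trans (xC≋yD j) (yD≋aU j)) (-ᵥ-ᵥ* a (vectors RD) j) ⟩
          (a ᵥ* vectors RD) j ⊕ - (a ᵥ* vectors RD) j ≈⟨ -‿inverseʳ _ ⟩
          0#                                         ∎)

    module _ (trivial : Trivial) where

      -- A relation of `T` puts `x₁ ᵥ* C` in RS D, with coefficients obtained by writing each basis
      -- vector as `N i ᵥ* D`. So `x₁` is zero, and the rest is a relation of the basis.
      T-independent : LinearlyIndependent T
      T-independent x eq = ≋0-take-drop k x₁≋0 (independent RD x₂ λ j → begin
        (x₂ ᵥ* vectors RD) j                       ≈⟨ +-identityˡ _ ⟨
        0# ⊕ (x₂ ᵥ* vectors RD) j                  ≈⟨ ⊕-congʳ (·-zeroˡ _ x₁≋0) ⟨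
        (x₁ ᵥ* C) j ⊕ (x₂ ᵥ* vectors RD) j         ≈⟨ ᵥ*-++ x C (vectors RD) j ⟨
        (x ᵥ* T) j                                 ≈⟨ eq j ⟩
        0#                                         ∎)
        where
        x₁ = take k x
        x₂ = drop k x
        N : Matrix (rank D) m
        N i = proj₁ (member RD i)
        x₁≋0 : x₁ ≋ 0ᵥ
        x₁≋0 = trivial x₁ (RS-complement D (x₂ ᵥ* N) λ j → begin
          (x₁ ᵥ* C) j ⊕ (x₂ ᵥ* N ᵥ* D) j             ≈⟨ ⊕-congˡ (ᵥ*-assoc x₂ N D j) ⟩
          (x₁ ᵥ* C) j ⊕ (x₂ ᵥ* (λ i → N i ᵥ* D)) j
            ≈⟨ ⊕-congˡ (ᵥ*-congˡ x₂ (λ i → proj₂ (member RD i)) j) ⟨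
          (x₁ ᵥ* C) j ⊕ (x₂ ᵥ* vectors RD) j         ≈⟨ ᵥ*-++ x C (vectors RD) j ⟨
          (x ᵥ* T) j                                 ≈⟨ eq j ⟩
          0#                                         ∎)

      module _ {z : Vector Carrier (k + m)} (z∈N : z ∈ NullSpace A) where

        lower-rows : ∀ j → (take k z ᵥ* C) j ⊕ (D *ᵥ drop k z) j ≈ 0#
        lower-rows j = begin
          (take k z ᵥ* C) j ⊕ (D *ᵥ drop k z) j        ≈⟨ ⊕-congʳ (·-comm (take k z) ((C ᵀ) j)) ⟩
          (C ᵀ *ᵥ take k z) j ⊕ (D *ᵥ drop k z) j      ≈⟨ block-*ᵥ-↑ʳ B C (C ᵀ) D z j ⟨
          (A *ᵥ z) (k ↑ʳ j)                            ≈⟨ z∈N (k ↑ʳ j) ⟩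
          0#                                           ∎

        -- The lower rows make `take k z ᵥ* C` the negative of `D *ᵥ drop k z`, which is a
        -- combination of the rows of `D` because `D` is symmetric.
        take≋0 : take k z ≋ 0ᵥ
        take≋0 = trivial (take k z) (RS-complement D (drop k z) λ j → trans
          (⊕-congˡ (sum-cong-≋ λ l → trans (*-comm _ _) (*-congʳ (D-symmetric l j))))
          (lower-rows j))

        drop∈NullSpace-C : drop k z ∈ NullSpace C
        drop∈NullSpace-C i = begin
          (C *ᵥ drop k z) i                            ≈⟨ +-identityˡ _ ⟨
          0# ⊕ (C *ᵥ drop k z) i                       ≈⟨ ⊕-congʳ (·-zeroʳ (B i) take≋0) ⟨
          (B *ᵥ take k z) i ⊕ (C *ᵥ drop k z) i        ≈⟨ block-*ᵥ-↑ˡ B C (C ᵀ) D z i ⟨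
          (A *ᵥ z) (i ↑ˡ m)                            ≈⟨ z∈N (i ↑ˡ m) ⟩
          0#                                           ∎

        drop∈NullSpace-D : drop k z ∈ NullSpace D
        drop∈NullSpace-D j = begin
          (D *ᵥ drop k z) j                            ≈⟨ +-identityˡ _ ⟨
          0# ⊕ (D *ᵥ drop k z) j                       ≈⟨ ⊕-congʳ (·-zeroˡ _ take≋0) ⟨
          (take k z ᵥ* C) j ⊕ (D *ᵥ drop k z) j        ≈⟨ lower-rows j ⟩
          0#                                           ∎

        drop∈NullSpace-T : drop k z ∈ NullSpace T
        drop∈NullSpace-T = NullSpace-++ C (vectors RD) drop∈NullSpace-C
          λ i → RS⊥NullSpace D (member RD i) drop∈NullSpace-D

      -- The first `k` coordinates vanish on the null space of `A`, so dropping them keeps its basis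
      -- independent. What remains is orthogonal to the independent rows of `T`.
      nullity≤ : nullity A + (k + rank D) ≤ m
      nullity≤ = orthogonal-independent⇒≤ {Z = λ i → drop k (vectors KA i)}
        (λ x eq → independent KA x (≋0-take-drop k
          (λ l → ·-zeroʳ x λ i → take≋0 (member KA i) l) eq))
        T-independent (λ i → drop∈NullSpace-T (member KA i))

      trivial⇒rank≡ : rank A ≡ k + (k + rank D)
      trivial⇒rank≡ = ℕₚ.≤-antisym rank≤
        -- Rank-nullity turns the upper bound on the nullity into a lower bound on the rank.
        (complement-≤ (nullity A) k (k + rank D) (rank-nullity A) nullity≤)

    trivial⇔≐0 : Trivial ⇔ (λ x → x ᵥ* C ∈ RS D) ≐ (_≋ 0ᵥ)
    trivial⇔≐0 = mk⇔
      (λ trivial → (λ {x} → trivial x) , λ {_} x≋0 → 0ᵥ , λ j →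
        trans (·-zeroˡ ((C ᵀ) j) x≋0) (sym (·-zeroˡ ((D ᵀ) j) λ _ → refl)))
      (λ (W⊆0 , _) x → W⊆0 {x})

    rank-formula⇔trivial : rank A ≡ rank D + 2 * k ⇔ Trivial
    rank-formula⇔trivial = mk⇔
      (λ eq → rank≡⇒trivial (≡.trans eq (r+2k≡k+[k+r] (rank D) k)))
      (λ trivial → ≡.trans (trivial⇒rank≡ trivial) (≡.sym (r+2k≡k+[k+r] (rank D) k)))
      where
      r+2k≡k+[k+r] : ∀ r k → r + 2 * k ≡ k + (k + r)
      r+2k≡k+[k+r] = solve-∀

    nullity-deleted : nullity (A ⟨ firstIndices k m ⟩) ≡ nullity D
    nullity-deleted = nullity-cast (∣∁firstIndices∣ k m) λ i j → reflexive (≡.trans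
      (≡.cong₂ A (outsiders-firstIndices k m i) (outsiders-firstIndices k m j))
      (block-↑ʳ-↑ʳ B C (C ᵀ) D _ _))

    PSet⇔rank-formula : PSet A (firstIndices k m) ⇔ rank A ≡ rank D + 2 * k
    PSet⇔rank-formula = ≡.subst₂ (λ d l → (d ≡ nullity A + l) ⇔ (rank A ≡ rank D + 2 * k))
      (≡.sym nullity-deleted) (≡.sym (∣firstIndices∣ k m))
      (complement-≡-⇔ (nullity A) (nullity D) k (rank-nullity A) (rank-nullity D))

theorem2p2 : ∀ {c ℓ₁ ℓ₂} (ℝ : RealNumbers c ℓ₁ ℓ₂) →
    let open RealMatrices ℝ in
    (k m : ℕ) (B : Matrix k k) (C : Matrix k m) (D : Matrix m m) →
    let A = block B C (C ᵀ) D in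
    Symmetric A →
    (PSet A (firstIndices k m) ⇔ rank A ≡ rank D + 2 * k)
    × (rank A ≡ rank D + 2 * k ⇔ (λ x → x ᵥ* C ∈ RS D) ≐ (_≋ 0ᵥ))
theorem2p2 ℝ k m B C D symmetric =
  PSet⇔rank-formula , (trivial⇔≐0 ⇔-∘ rank-formula⇔trivial)
  where open LinearAlgebra.BlockMatrix ℝ B C D symmetric
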